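{- Let $N$ and $\rho$ be integers with $1<\rho<N$, and let $q=(q')^{\rho+1}$ for any prime power $q'$. Then \[ s_q(N,\rho)\le\frac{(\rho+1)(\rho+2)}{2}(q')^{N-\rho}+\rho(\rho+1)\frac{(q')^{N-\rho}-1}{q'-1}. \]
   Context: A point $P$ of $\mathrm{PG}(N,q)$ is $\rho$-saturated by a point set $\mathcal{S}$ if there exists a subspace through $P$ of dimension at most $\rho$ spanned by points of $\mathcal{S}$. A point set $\mathcal{S}$ is a $\rho$-saturating set of $\mathrm{PG}(N,q)$ if $\rho$ is the least integer such that all points of $\mathrm{PG}(N,q)$ are $\rho$-saturated by $\mathcal{S}$. $s_q(N,\rho)$ denotes the minimum size of a $\rho$-saturating set of $\mathrm{PG}(N,q)$. -}

module Defs where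

open import Level using (0ℓ)
open import Data.Nat as ℕ using (ℕ; suc; _^_; _≤_)
open import Data.Nat.Primality using (Prime)
open import Data.Fin using (Fin)
open import Data.List using (List; []; _∷_; length)
open import Data.List.Membership.Propositional using (_∈_)
open import Data.List.Relation.Unary.All using (All)
open import Data.List.Relation.Unary.AllPairs using (AllPairs)
open import Data.Product using (Σ; ∃; _×_; _,_)
open import Relation.Binary.PropositionalEquality using (_≡_; _≢_)
open import Relation.Nullary using (¬_)
open import Algebra.Structures using (IsCommutativeRing)
open import Function.Bundles using (_↔_)

IsPrimePower : ℕ → Set
IsPrimePower n = Σ ℕ λ p → Σ ℕ λ k → Prime p × 1 ≤ k × n ≡ p ^ k

record FiniteField : Set₁ where
  infixl 6 _+_
  infixl 7 _*_
  field
    Carrier  : Set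
    _+_ _*_  : Carrier → Carrier → Carrier
    -_       : Carrier → Carrier
    0# 1#    : Carrier
    isCommutativeRing : IsCommutativeRing _≡_ _+_ _*_ -_ 0# 1#
    0≢1      : 0# ≢ 1#
    _⁻¹      : Carrier → Carrier
    inverse  : ∀ x → x ≢ 0# → x * (x ⁻¹) ≡ 1#
    order    : ℕ
    enum     : Fin order ↔ Carrier

module Projective (F : FiniteField) (N : ℕ) where
  open FiniteField F

  Vec : Set
  Vec = Fin (suc N) → Carrier

  zeroV : Vec
  zeroV _ = 0#

  _+V_ : Vec → Vec → Vec
  (u +V v) i = u i + v i

  _·_ : Carrier → Vec → Vec
  (c · v) i = c * v i

  NonZero : Vec → Set
  NonZero v = ¬ (∀ i → v i ≡ 0#)

  -- u and v represent the same projective point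
  Proportional : Vec → Vec → Set
  Proportional u v = Σ Carrier λ c → c ≢ 0# × (∀ i → u i ≡ c * v i)

  -- a point set of PG(N,q): a list of representatives of pairwise
  -- distinct projective points; its size is its length
  IsPointSet : List Vec → Set
  IsPointSet S = All NonZero S × AllPairs (λ u v → ¬ Proportional u v) S

  lincomb : List (Carrier × Vec) → Vec
  lincomb [] = zeroV
  lincomb ((c , v) ∷ xs) = (c · v) +V lincomb xs

  points : List (Carrier × Vec) → List Vec
  points [] = []
  points ((c , v) ∷ xs) = v ∷ points xs

  -- P is r-saturated by S: P lies in a subspace of (projective) dimension
  -- at most r spanned by points of S, i.e. P is a linear combination of
  -- at most r+1 points of S.
  Saturated : ℕ → List Vec → Vec → Set
  Saturated r S P = Σ (List (Carrier × Vec)) λ xs →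
      length xs ≤ suc r × All (_∈ S) (points xs) × (∀ i → P i ≡ lincomb xs i)

  AllSaturated : ℕ → List Vec → Set
  AllSaturated r S = ∀ P → NonZero P → Saturated r S P

  IsSaturatingSet : ℕ → List Vec → Set
  IsSaturatingSet ρ S =
    IsPointSet S × AllSaturated ρ S × (∀ r → r ℕ.< ρ → ¬ AllSaturated r S)

{-# OPTIONS --safe #-}

-- Write m = ρ + 1, n = N − ρ, s = q', and let K = {x : xˢ = x} be the subfield
-- of order s, so that F has dimension m over K. Let S consist of the points
-- (eᵢ , b x) with i < m, x ∈ Kⁿ and b one of i + 1 fixed K-independent elements
-- of F, together with the points (0 , x) of PG(n − 1, s) at infinity.
--
-- Given a target (a , y), choose u₀, u₁, … ∈ F one after the other so that they
-- stay K-independent: if aᵢ ≠ 0 then one of the i + 1 products aᵢ b lies outside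
-- the i-dimensional span of u₀, …, uᵢ₋₁, and it becomes uᵢ; if aᵢ = 0 then any
-- new uᵢ will do. The uᵢ form a K-basis of F, so y = Σ uᵢ xᵢ with xᵢ ∈ Kⁿ, and
-- (aᵢ eᵢ , uᵢ xᵢ) is a multiple of (eᵢ , b xᵢ) or of (0 , xᵢ). Hence m points
-- suffice; m are needed for the all-one vector, because every point of S has at
-- most one nonzero entry among its first m. Finally
-- |S| ≤ m(m + 1)/2 sⁿ + (sⁿ − 1)/(s − 1).
--
-- That K has exactly s elements follows by bounding numbers of roots:
-- those of xˢ − x from above by s, and those of the quotient of x^|F| − x by it
-- from above by |F| − s.
module Submission where

open import Defs
open import Algebra.Bundles using (CommutativeRing)
open import Data.Empty using (⊥-elim)
open import Data.Fin using (Fin; zero; suc; toℕ; fromℕ; fromℕ<; inject₁; cast; _↑ˡ_; _↑ʳ_; splitAt; join)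
open import Data.Fin using (quotient; remainder; combine; finToFun; funToFin)
open import Data.Fin.Permutation using (Permutation′; permutation)
import Data.Fin.Properties as Fin
open import Data.List as List using (List; []; _∷_; length; filter; lookup; tabulate; allFin; concatMap)
open import Data.List.Membership.Propositional using (_∈_; find; lose)
open import Data.List.Membership.Propositional.Properties using (∈-filter⁺; ∈-filter⁻; ∈-tabulate⁺; ∈-lookup)
open import Data.List.Membership.Propositional.Properties using (∈-++⁺ˡ; ∈-++⁺ʳ; ∈-map⁺; ∈-allFin; ∈-concatMap⁺)
open import Data.List.Properties using (length-tabulate; length-++; length-map)
open import Data.List.Relation.Unary.All as All using (All; []; _∷_)
open import Data.List.Relation.Unary.All.Properties using (all-filter; ¬Any⇒All¬; ++⁺; map⁺; concat⁺)
open import Data.List.Relation.Unary.AllPairs using ([]; _∷_)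
open import Data.List.Relation.Unary.Any as Any using (Any; here; there)
open import Data.List.Relation.Unary.Any.Properties using (lookup-index)
open import Data.List.Relation.Unary.Unique.Propositional using (Unique)
import Data.List.Relation.Unary.Unique.Propositional.Properties as Unique
import Data.Nat as ℕ
open import Data.Nat using (ℕ; zero; suc; _≤_; _<_; _∸_; s≤s; z≤n)
open import Data.Nat.Base using (_!)
open import Data.Nat.Combinatorics using (_C_; nCn≡1; nCk≡nC[n∸k]; nCk≡n!/k![n-k]!; k![n∸k]!∣n!)
open import Data.Nat.DivMod using (m/n*n≡m)
open import Data.Nat.Divisibility using (_∣_; divides; ∣1⇒≡1; ∣⇒≤; m∣m*n)
open import Data.Nat.Primality using (Prime; euclidsLemma; prime⇒nonZero; prime⇒nonTrivial)
import Data.Nat.Properties as ℕ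
import Data.Nat.Solver as ℕSolver
open import Data.Product using (Σ; ∃; _×_; _,_; proj₁; proj₂)
open import Data.Sum using (_⊎_; inj₁; inj₂)
open import Data.Unit using (⊤)
open import Data.Vec using (Vec; []; _∷_; replicate; _++_; map; toList)
import Data.Vec.Functional as Vector
open import Data.Vec.Functional.Properties using (lookup-++ˡ; lookup-++ʳ)
import Data.Vec.Relation.Unary.All as VecAll
open import Function using (_∘_; _$_)
open import Function.Bundles using (module Inverse)
open import Relation.Binary.PropositionalEquality
open import Relation.Nullary using (¬_; yes; no; Dec)
open import Relation.Nullary.Decidable using (map′; ¬?; _×-dec_)
open ≡-Reasoning

-- Arithmetic of factorials, binomial coefficients and geometric sums

prime∤! : ∀ {p} → Prime p → ∀ k → k < p → ¬ p ∣ k !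
prime∤! {p} pr zero k<p d with ∣1⇒≡1 d
... | refl = ℕ.<-irrefl refl (ℕ.nonTrivial⇒n>1 p {{prime⇒nonTrivial pr}})
prime∤! pr (suc k) k<p d with euclidsLemma (suc k) (k !) pr d
... | inj₁ d′ = ℕ.<⇒≱ k<p (∣⇒≤ d′)
... | inj₂ d′ = prime∤! pr k (ℕ.<-trans (ℕ.n<1+n k) k<p) d′

-- Multiplying `p C k` by `k !` and `(p ∸ k) !` gives `p !`, a multiple of `p`. Both factorials are
-- built from factors below `p`, so Euclid's lemma leaves only the binomial coefficient.
prime∣C : ∀ {p} → Prime p → ∀ k → 0 < k → k < p → p ∣ p C k
prime∣C {p@(suc p′)} pr k@(suc k′) _ k<p with euclidsLemma (p C k) (k ! ℕ.* (p ∸ k) !) pr p∣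
  where
  instance _ = (k ℕ.!* (p ∸ k) !≢0)
  p∣ : p ∣ (p C k) ℕ.* (k ! ℕ.* (p ∸ k) !)
  p∣ = subst (p ∣_) (sym (begin
    (p C k) ℕ.* (k ! ℕ.* (p ∸ k) !)
      ≡⟨ cong (ℕ._* (k ! ℕ.* (p ∸ k) !)) (nCk≡n!/k![n-k]! (ℕ.<⇒≤ k<p)) ⟩
    p ! ℕ./ (k ! ℕ.* (p ∸ k) !) ℕ.* (k ! ℕ.* (p ∸ k) !)
      ≡⟨ m/n*n≡m (k![n∸k]!∣n! (ℕ.<⇒≤ k<p)) ⟩
    p ! ∎)) (m∣m*n (p′ !))
... | inj₁ d = d
... | inj₂ d with euclidsLemma (k !) ((p ∸ k) !) pr d
... | inj₁ d′ = ⊥-elim (prime∤! pr k k<p d′)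
... | inj₂ d′ = ⊥-elim (prime∤! pr (p ∸ k) (s≤s (ℕ.m∸n≤m p′ k′)) d′)

-- 1 + s + … + sⁿ⁻¹
geo : ℕ → ℕ → ℕ
geo s zero    = 0
geo s (suc n) = s ℕ.^ n ℕ.+ geo s n

geo>0 : ∀ s .{{_ : ℕ.NonZero s}} n → 0 < geo s (suc n)
geo>0 s n = ℕ.<-≤-trans (ℕ.m^n>0 s n) (ℕ.m≤m+n (s ℕ.^ n) (geo s n))

-- Writing s as t + 2 keeps the geometric sum formula free of subtraction. It serves twice: to split
-- the order of the field for the root count, and to clear the denominator s - 1 in the final bound.
s^n≡1+[s-1]geo : ∀ t n → suc (suc t) ℕ.^ n ≡ suc (suc t ℕ.* geo (suc (suc t)) n)
s^n≡1+[s-1]geo t zero    = cong suc (sym (ℕ.*-zeroʳ (suc t)))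
s^n≡1+[s-1]geo t (suc n) = begin
  s ℕ.^ n ℕ.+ suc t ℕ.* s ℕ.^ n                    ≡⟨ cong (ℕ._+ suc t ℕ.* s ℕ.^ n) (s^n≡1+[s-1]geo t n) ⟩
  suc (suc t ℕ.* geo s n ℕ.+ suc t ℕ.* s ℕ.^ n)    ≡⟨ cong suc (ℕ.*-distribˡ-+ (suc t) (geo s n) (s ℕ.^ n)) ⟨
  suc (suc t ℕ.* (geo s n ℕ.+ s ℕ.^ n))            ≡⟨ cong (λ g → suc (suc t ℕ.* g)) (ℕ.+-comm (geo s n) _) ⟩
  suc (suc t ℕ.* geo s (suc n))                    ∎
  where
  s : ℕ
  s = suc (suc t)

length-filter-¬ : ∀ {A : Set} {P : A → Set} (P? : ∀ x → Dec (P x)) xs →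
                  length (filter P? xs) ℕ.+ length (filter (¬? ∘ P?) xs) ≡ length xs
length-filter-¬ P? []       = refl
length-filter-¬ P? (x ∷ xs) with P? x
... | yes _ = cong suc (length-filter-¬ P? xs)
... | no  _ = trans (ℕ.+-suc _ _) (cong suc (length-filter-¬ P? xs))

unique-lookup-injective : ∀ {A : Set} {xs : List A} → Unique xs → ∀ {i j} → lookup xs i ≡ lookup xs j → i ≡ j
unique-lookup-injective (_ ∷ _)    {zero}  {zero}  _  = refl
unique-lookup-injective (x∉ ∷ _)   {zero}  {suc j} eq = ⊥-elim (All.lookup x∉ (∈-lookup j) eq)
unique-lookup-injective (x∉ ∷ _)   {suc i} {zero}  eq = ⊥-elim (All.lookup x∉ (∈-lookup i) (sym eq))
unique-lookup-injective (_ ∷ uniq) {suc i} {suc j} eq = cong suc (unique-lookup-injective uniq eq)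

-- Finite fields: arithmetic, sums and products over all elements

module Field (F : FiniteField) where
  open FiniteField F public

  commutativeRing : CommutativeRing _ _
  commutativeRing = record { isCommutativeRing = isCommutativeRing }

  open CommutativeRing commutativeRing public
    using (+-assoc; +-comm; +-identityˡ; +-identityʳ; -‿inverseˡ; -‿inverseʳ;
           *-assoc; *-comm; *-identityˡ; *-identityʳ; distribˡ; zeroˡ; zeroʳ;
           ring; semiring; commutativeSemiring; +-group; +-commutativeMonoid; *-commutativeMonoid)
  open import Algebra.Properties.Ring ring public
    using (-‿distribˡ-*; -‿distribʳ-*)
  open import Algebra.Properties.Group +-group public using ()
    renaming (∙-cancelˡ to +-cancelˡ; ∙-cancelʳ to +-cancelʳ)
  open import Algebra.Properties.Semiring.Exp semiring public
    using (_^_; ^-assocʳ)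
  open import Algebra.Properties.CommutativeSemiring.Exp commutativeSemiring public
    using (^-distrib-*)
  open import Algebra.Properties.Semiring.Mult semiring public
    using (×1-homo-*; ×-assoc-*) renaming (_×_ to _⋆_)
  open import Algebra.Solver.Ring.NaturalCoefficients.Default commutativeSemiring public
    using (solve; _:+_; _:*_; _:=_)
  import Algebra.Properties.CommutativeMonoid.Sum +-commutativeMonoid as ∑
  import Algebra.Properties.CommutativeMonoid.Sum *-commutativeMonoid as ∏
  import Algebra.Properties.CommutativeSemiring.Binomial commutativeSemiring as Binomial

  elt : Fin order → Carrier
  elt = Inverse.to enum

  ix : Carrier → Fin order
  ix = Inverse.from enum

  elt-ix : ∀ x → elt (ix x) ≡ x
  elt-ix = Inverse.strictlyInverseˡ enum

  ix-elt : ∀ i → ix (elt i) ≡ i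
  ix-elt = Inverse.strictlyInverseʳ enum

  elt-injective : ∀ {i j} → elt i ≡ elt j → i ≡ j
  elt-injective {i} {j} eq = trans (sym (ix-elt i)) (trans (cong ix eq) (ix-elt j))

  ix-injective : ∀ {x y} → ix x ≡ ix y → x ≡ y
  ix-injective {x} {y} eq = trans (sym (elt-ix x)) (trans (cong elt eq) (elt-ix y))

  infix 4 _≟_
  _≟_ : (x y : Carrier) → Dec (x ≡ y)
  x ≟ y = map′ ix-injective (cong ix) (ix x Fin.≟ ix y)

  infixl 6 _-_
  _-_ : Carrier → Carrier → Carrier
  x - y = x + - y

  x-y+y≡x : ∀ x y → x - y + y ≡ x
  x-y+y≡x x y = trans (+-assoc x (- y) y) (trans (cong (x +_) (-‿inverseˡ y)) (+-identityʳ x))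

  x-y≡0⇒x≡y : ∀ {x y} → x - y ≡ 0# → x ≡ y
  x-y≡0⇒x≡y {x} {y} eq = trans (sym (x-y+y≡x x y)) (trans (cong (_+ y) eq) (+-identityˡ y))

  inverseˡ : ∀ x → x ≢ 0# → x ⁻¹ * x ≡ 1#
  inverseˡ x x≢0 = trans (*-comm _ x) (inverse x x≢0)

  x⁻¹[xy]≡y : ∀ {x} → x ≢ 0# → ∀ y → x ⁻¹ * (x * y) ≡ y
  x⁻¹[xy]≡y {x} x≢0 y = begin
    x ⁻¹ * (x * y) ≡⟨ *-assoc _ x y ⟨
    x ⁻¹ * x * y   ≡⟨ cong (_* y) (inverseˡ x x≢0) ⟩
    1# * y         ≡⟨ *-identityˡ y ⟩
    y              ∎

  x[x⁻¹y]≡y : ∀ {x} → x ≢ 0# → ∀ y → x * (x ⁻¹ * y) ≡ y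
  x[x⁻¹y]≡y {x} x≢0 y = begin
    x * (x ⁻¹ * y) ≡⟨ *-assoc x _ y ⟨
    x * x ⁻¹ * y   ≡⟨ cong (_* y) (inverse x x≢0) ⟩
    1# * y         ≡⟨ *-identityˡ y ⟩
    y              ∎

  *-cancelˡ : ∀ {x y z} → x ≢ 0# → x * y ≡ x * z → y ≡ z
  *-cancelˡ {x} {y} {z} x≢0 eq =
    trans (sym (x⁻¹[xy]≡y x≢0 y)) (trans (cong (x ⁻¹ *_) eq) (x⁻¹[xy]≡y x≢0 z))

  *-cancelʳ : ∀ {x y z} → x ≢ 0# → y * x ≡ z * x → y ≡ z
  *-cancelʳ {x} {y} {z} x≢0 eq =
    *-cancelˡ x≢0 (trans (*-comm x y) (trans eq (*-comm z x)))

  *-≢0 : ∀ {x y} → x ≢ 0# → y ≢ 0# → x * y ≢ 0#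
  *-≢0 {x} x≢0 y≢0 eq = y≢0 (*-cancelˡ x≢0 (trans eq (sym (zeroʳ x))))

  ^-≢0 : ∀ {x} → x ≢ 0# → ∀ n → x ^ n ≢ 0#
  ^-≢0 x≢0 zero    = 0≢1 ∘ sym
  ^-≢0 x≢0 (suc n) = *-≢0 x≢0 (^-≢0 x≢0 n)

  bijection⇒permutation : (f g : Carrier → Carrier) → (∀ x → f (g x) ≡ x) → (∀ x → g (f x) ≡ x) →
                          Permutation′ order
  bijection⇒permutation f g fg gf = permutation (ix ∘ f ∘ elt) (ix ∘ g ∘ elt)
    (λ i → trans (cong (ix ∘ f) (elt-ix _)) (trans (cong ix (fg _)) (ix-elt i)))
    (λ i → trans (cong (ix ∘ g) (elt-ix _)) (trans (cong ix (gf _)) (ix-elt i)))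

  -- Translation by 1 permutes F, so summing over F gives order · 1 = 0.
  order⋆1≡0 : order ⋆ 1# ≡ 0#
  order⋆1≡0 = sym (+-cancelˡ (∑.sum elt) _ _ (begin
    ∑.sum elt + 0#                         ≡⟨ +-identityʳ _ ⟩
    ∑.sum elt                              ≡⟨ ∑.sum-permute elt π ⟩
    ∑.sum (λ i → elt (ix (elt i + 1#)))    ≡⟨ ∑.sum-cong-≗ (λ i → elt-ix (elt i + 1#)) ⟩
    ∑.sum (λ i → elt i + 1#)               ≡⟨ ∑.∑-distrib-+ elt (λ _ → 1#) ⟩
    ∑.sum elt + ∑.sum {order} (λ _ → 1#)   ≡⟨ cong (∑.sum elt +_) (∑.sum-replicate order) ⟩
    ∑.sum elt + order ⋆ 1#                 ∎))
    where
    π : Permutation′ order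
    π = bijection⇒permutation (_+ 1#) (_- 1#) (λ x → x-y+y≡x x 1#)
      (λ x → trans (+-assoc x 1# _) (trans (cong (x +_) (-‿inverseʳ 1#)) (+-identityʳ x)))

  ∏-single : ∀ {n} (i : Fin n) (h : Fin n → Carrier) → (∀ j → j ≢ i → h j ≡ 1#) → ∏.sum h ≡ h i
  ∏-single {suc n} zero h h≡1 = begin
    h zero * ∏.sum (h ∘ suc)          ≡⟨ cong (h zero *_) (∏.sum-cong-≗ (λ j → h≡1 (suc j) λ ())) ⟩
    h zero * ∏.sum {n} (λ _ → 1#)     ≡⟨ cong (h zero *_) (∏.sum-replicate-zero n) ⟩
    h zero * 1#                       ≡⟨ *-identityʳ _ ⟩
    h zero                            ∎
  ∏-single (suc i) h h≡1 = begin
    h zero * ∏.sum (h ∘ suc)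
      ≡⟨ cong₂ _*_ (h≡1 zero λ ()) (∏-single i (h ∘ suc) (λ j j≢i → h≡1 (suc j) (j≢i ∘ Fin.suc-injective))) ⟩
    1# * h (suc i)            ≡⟨ *-identityˡ _ ⟩
    h (suc i)                 ∎

  ∏-≢0 : ∀ {n} (h : Fin n → Carrier) → (∀ i → h i ≢ 0#) → ∏.sum h ≢ 0#
  ∏-≢0 {zero}  h h≢0 = 0≢1 ∘ sym
  ∏-≢0 {suc n} h h≢0 = *-≢0 (h≢0 zero) (∏-≢0 (h ∘ suc) (h≢0 ∘ suc))

  infix 5 _atZero_
  _atZero_ : Carrier → (Carrier → Carrier) → Carrier → Carrier
  (c atZero f) x with x ≟ 0#
  ... | yes _ = c
  ... | no  _ = f x

  -- Multiplication by a permutes the nonzero elements; the factors at 0 are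
  -- tracked separately so that all products range over the whole of F.
  fermat : ∀ a → a ^ order ≡ a
  fermat a with a ≟ 0#
  -- The index `ix 0#` inhabits `Fin order`, so the exponent is positive and the power is not the
  -- empty product.
  ... | yes refl = 0^ order (ix 0#)
    where
    0^ : ∀ n → Fin n → 0# ^ n ≡ 0#
    0^ (suc n) _ = zeroˡ _
  ... | no a≢0 = begin
    a ^ order                        ≡⟨ ∏.sum-replicate order ⟨
    ∏.sum {order} (λ _ → a)          ≡⟨ ∏.sum-cong-≗ (cd ∘ elt) ⟨
    ∏.sum (λ i → c (elt i) * d (elt i))      ≡⟨ ∏.∑-distrib-+ (c ∘ elt) (d ∘ elt) ⟩
    ∏.sum (c ∘ elt) * ∏.sum (d ∘ elt) ≡⟨ cong₂ _*_ ∏c≡1 (∏-single (ix 0#) (d ∘ elt) d≡1) ⟩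
    1# * d (elt (ix 0#))             ≡⟨ *-identityˡ _ ⟩
    d (elt (ix 0#))                  ≡⟨ cong d (elt-ix 0#) ⟩
    d 0#                             ≡⟨ d0≡a ⟩
    a                                ∎
    where
    -- The constant `a` splits as `c x * d x`, where `c` carries it at nonzero x and `d` at 0. The
    -- map `g` replaces 0 by 1, so its product over F is nonzero; replacing x by `a * x` changes
    -- `g x` by the factor `c x`, and cancelling the product of `g` shows that `c` has product 1.
    c d g : Carrier → Carrier
    c = 1# atZero (λ _ → a)
    d = a atZero (λ _ → 1#)
    g = 1# atZero (λ x → x)

    cd : ∀ x → c x * d x ≡ a
    cd x with x ≟ 0#
    ... | yes _ = *-identityˡ a
    ... | no  _ = *-identityʳ a

    d0≡a : d 0# ≡ a
    d0≡a with 0# ≟ 0#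
    ... | yes _ = refl
    ... | no 0≢0 = ⊥-elim (0≢0 refl)

    d≡1 : ∀ i → i ≢ ix 0# → d (elt i) ≡ 1#
    d≡1 i i≢ with elt i ≟ 0#
    ... | yes eq = ⊥-elim (i≢ (trans (sym (ix-elt i)) (cong ix eq)))
    ... | no  _  = refl

    g≢0 : ∀ x → g x ≢ 0#
    g≢0 x with x ≟ 0#
    ... | yes _   = 0≢1 ∘ sym
    ... | no  x≢0 = x≢0

    g-scale : ∀ x → g (a * x) ≡ c x * g x
    g-scale x with x ≟ 0# | a * x ≟ 0#
    ... | yes _    | yes _   = sym (*-identityˡ 1#)
    ... | yes refl | no ax≢0 = ⊥-elim (ax≢0 (zeroʳ a))
    ... | no x≢0   | yes eq  = ⊥-elim (*-≢0 a≢0 x≢0 eq)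
    ... | no _     | no _    = refl

    π : Permutation′ order
    π = bijection⇒permutation (a *_) (a ⁻¹ *_) (x[x⁻¹y]≡y a≢0) (x⁻¹[xy]≡y a≢0)

    ∏c≡1 : ∏.sum (c ∘ elt) ≡ 1#
    ∏c≡1 = *-cancelʳ (∏-≢0 (g ∘ elt) (g≢0 ∘ elt)) (begin
      ∏.sum (c ∘ elt) * ∏.sum (g ∘ elt)    ≡⟨ ∏.∑-distrib-+ (c ∘ elt) (g ∘ elt) ⟨
      ∏.sum (λ i → c (elt i) * g (elt i))  ≡⟨ ∏.sum-cong-≗ (g-scale ∘ elt) ⟨
      ∏.sum (λ i → g (a * elt i))          ≡⟨ ∏.sum-cong-≗ (λ i → cong g (elt-ix (a * elt i))) ⟨
      ∏.sum (λ i → g (elt (ix (a * elt i)))) ≡⟨ ∏.sum-permute (g ∘ elt) π ⟨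
      ∏.sum (g ∘ elt)                      ≡⟨ *-identityˡ _ ⟨
      1# * ∏.sum (g ∘ elt)                 ∎)

  -- Polynomials and their roots

  -- The monic polynomial xᵈ + … + c₁ x + c₀ with the given lower coefficients.
  monic : ∀ {d} → Vec Carrier d → Carrier → Carrier
  monic []       x = 1#
  monic (c ∷ cs) x = c + x * monic cs x

  -- f(x) − f(a) = (x − a) h(x), with the negative terms moved across.
  factor : ∀ {d} (cs : Vec Carrier (suc d)) a →
           Σ (Vec Carrier d) λ hs → ∀ x → monic cs x + a * monic hs x ≡ monic cs a + x * monic hs x
  factor (c ∷ []) a = [] , λ x → solve 3 (λ c x a → c :+ x :+ a := c :+ a :+ x) refl c (x * 1#) (a * 1#)
  factor (c ∷ cs@(_ ∷ _)) a with factor cs a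
  ... | hs , eq = monic cs a ∷ hs , λ x → begin
    c + x * monic cs x + a * (monic cs a + x * monic hs x)
      ≡⟨ solve 6 (λ c x a f g h → c :+ x :* f :+ a :* (g :+ x :* h) := c :+ a :* g :+ x :* (f :+ a :* h))
           refl c x a (monic cs x) (monic cs a) (monic hs x) ⟩
    c + a * monic cs a + x * (monic cs x + a * monic hs x)
      ≡⟨ cong (λ y → c + a * monic cs a + x * y) (eq x) ⟩
    c + a * monic cs a + x * (monic cs a + x * monic hs x) ∎

  -- Induction on the degree. Splitting off the root `a` leaves a quotient h of degree one less, and
  -- any other root r satisfies a h(r) = r h(r) with a ≠ r, which forces h(r) = 0.
  #roots≤degree : ∀ {d} (cs : Vec Carrier d) {rs} → Unique rs → All (λ r → monic cs r ≡ 0#) rs → length rs ≤ d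
  #roots≤degree cs [] [] = z≤n
  #roots≤degree [] (_ ∷ _) (1≡0 ∷ _) = ⊥-elim (0≢1 (sym 1≡0))
  #roots≤degree cs@(_ ∷ _) {a ∷ rs} (a∉rs ∷ unique) (fa≡0 ∷ fr≡0) with factor cs a
  ... | hs , eq = s≤s (#roots≤degree hs unique (All.zipWith h≡0 (a∉rs , fr≡0)))
    where
    h≡0 : ∀ {r} → a ≢ r × monic cs r ≡ 0# → monic hs r ≡ 0#
    h≡0 {r} (a≢r , fr≡0) with monic hs r ≟ 0#
    ... | yes h≡0 = h≡0
    ... | no  h≢0 = ⊥-elim (a≢r (*-cancelʳ h≢0 (begin
      a * monic hs r               ≡⟨ +-identityˡ _ ⟨
      0# + a * monic hs r          ≡⟨ cong (_+ a * monic hs r) fr≡0 ⟨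
      monic cs r + a * monic hs r  ≡⟨ eq r ⟩
      monic cs a + r * monic hs r  ≡⟨ cong (_+ r * monic hs r) fa≡0 ⟩
      0# + r * monic hs r          ≡⟨ +-identityˡ _ ⟩
      r * monic hs r               ∎)))

  monic-shift : ∀ t {d} (cs : Vec Carrier d) x → monic (replicate t 0# ++ cs) x ≡ x ^ t * monic cs x
  monic-shift zero    cs x = sym (*-identityˡ _)
  monic-shift (suc t) cs x = begin
    0# + x * monic (replicate t 0# ++ cs) x ≡⟨ +-identityˡ _ ⟩
    x * monic (replicate t 0# ++ cs) x      ≡⟨ cong (x *_) (monic-shift t cs x) ⟩
    x * (x ^ t * monic cs x)                ≡⟨ *-assoc x _ _ ⟨
    x * x ^ t * monic cs x                  ∎

  -- Characteristic and the Frobenius map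

  ⋆-multiple : ∀ {p n} → p ⋆ 1# ≡ 0# → p ∣ n → ∀ x → n ⋆ x ≡ 0#
  ⋆-multiple {p} p⋆1≡0 (divides c refl) x = begin
    (c ℕ.* p) ⋆ x              ≡⟨ cong ((c ℕ.* p) ⋆_) (*-identityˡ x) ⟨
    (c ℕ.* p) ⋆ (1# * x)       ≡⟨ ×-assoc-* (c ℕ.* p) 1# x ⟨
    ((c ℕ.* p) ⋆ 1#) * x       ≡⟨ cong (_* x) (×1-homo-* c p) ⟩
    (c ⋆ 1#) * (p ⋆ 1#) * x    ≡⟨ cong (λ z → (c ⋆ 1#) * z * x) p⋆1≡0 ⟩
    (c ⋆ 1#) * 0# * x          ≡⟨ cong (_* x) (zeroʳ _) ⟩
    0# * x                     ≡⟨ zeroˡ x ⟩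
    0#                         ∎

  ^⋆1≢0 : ∀ {p} → p ⋆ 1# ≢ 0# → ∀ e → (p ℕ.^ e) ⋆ 1# ≢ 0#
  ^⋆1≢0 p≢0 zero eq = 0≢1 (sym (trans (sym (+-identityʳ 1#)) eq))
  ^⋆1≢0 {p} p≢0 (suc e) eq = *-≢0 p≢0 (^⋆1≢0 p≢0 e) (trans (sym (×1-homo-* p (p ℕ.^ e))) eq)

  -- A field has no zero divisors, so if `p ⋆ 1#` were nonzero, every power of p would be nonzero in
  -- F, contrary to `order⋆1≡0`.
  characteristic : ∀ p e → order ≡ p ℕ.^ e → p ⋆ 1# ≡ 0#
  characteristic p e eq with p ⋆ 1# ≟ 0#
  ... | yes p≡0 = p≡0
  ... | no  p≢0 = ⊥-elim (^⋆1≢0 p≢0 e (trans (cong (_⋆ 1#) (sym eq)) order⋆1≡0))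

  -- In the binomial expansion all inner coefficients are multiples of `p` by `prime∣C` and vanish
  -- in F, so only the two end terms survive.
  frobenius : ∀ {p} → Prime p → p ⋆ 1# ≡ 0# → ∀ x y → (x + y) ^ p ≡ x ^ p + y ^ p
  frobenius {zero}   pr _ x y with () ← prime⇒nonZero pr
  frobenius {p@(suc p′)} pr p⋆1≡0 x y = begin
    (x + y) ^ p                              ≡⟨ Binomial.theorem p x y ⟩
    t zero + ∑.sum (t ∘ suc)                 ≡⟨ cong (t zero +_) (∑.sum-init-last (t ∘ suc)) ⟩
    t zero + (∑.sum (t ∘ suc ∘ inject₁) + t (fromℕ p))
      ≡⟨ cong (λ z → t zero + (z + t (fromℕ p))) (trans (∑.sum-cong-≗ middle) (∑.sum-replicate-zero p′)) ⟩
    t zero + (0# + t (fromℕ p))              ≡⟨ cong (t zero +_) (+-identityˡ _) ⟩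
    t zero + t (fromℕ p)                     ≡⟨ cong₂ _+_ first last ⟩
    y ^ p + x ^ p                            ≡⟨ +-comm _ _ ⟩
    x ^ p + y ^ p                            ∎
    where
    t : Fin (suc p) → Carrier
    t = Binomial.binomialTerm x y p

    middle : ∀ i → t (suc (inject₁ i)) ≡ 0#
    middle i = ⋆-multiple p⋆1≡0
      (prime∣C pr _ (s≤s z≤n) (s≤s (subst (_< p′) (sym (Fin.toℕ-inject₁ i)) (Fin.toℕ<n i)))) _

    first : t zero ≡ y ^ p
    first = begin
      (p C 0) ⋆ (1# * y ^ p) ≡⟨ cong (_⋆ (1# * y ^ p)) (trans (nCk≡nC[n∸k] {0} {p} z≤n) (nCn≡1 p)) ⟩
      1# * y ^ p + 0#        ≡⟨ +-identityʳ _ ⟩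
      1# * y ^ p             ≡⟨ *-identityˡ _ ⟩
      y ^ p                  ∎

    last : t (fromℕ p) ≡ x ^ p
    last = begin
      (p C toℕ (fromℕ p)) ⋆ (x ^ toℕ (fromℕ p) * y ^ (p ∸ toℕ (fromℕ p)))
        ≡⟨ cong (λ k → (p C k) ⋆ (x ^ k * y ^ (p ∸ k))) (Fin.toℕ-fromℕ p) ⟩
      (p C p) ⋆ (x ^ p * y ^ (p ∸ p))
        ≡⟨ cong₂ (λ k l → k ⋆ (x ^ p * y ^ l)) (nCn≡1 p) (ℕ.n∸n≡0 p) ⟩
      x ^ p * 1# + 0#        ≡⟨ +-identityʳ _ ⟩
      x ^ p * 1#             ≡⟨ *-identityʳ _ ⟩
      x ^ p                  ∎

  frobenius^ : ∀ {p} → Prime p → p ⋆ 1# ≡ 0# → ∀ k x y →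
               (x + y) ^ (p ℕ.^ k) ≡ x ^ (p ℕ.^ k) + y ^ (p ℕ.^ k)
  frobenius^ pr p⋆1≡0 zero x y =
    trans (*-identityʳ _) (sym (cong₂ _+_ (*-identityʳ x) (*-identityʳ y)))
  frobenius^ {p} pr p⋆1≡0 (suc k) x y = begin
    (x + y) ^ (p ℕ.* p ℕ.^ k)              ≡⟨ ^-assocʳ (x + y) p (p ℕ.^ k) ⟨
    ((x + y) ^ p) ^ (p ℕ.^ k)              ≡⟨ cong (_^ (p ℕ.^ k)) (frobenius pr p⋆1≡0 x y) ⟩
    (x ^ p + y ^ p) ^ (p ℕ.^ k)            ≡⟨ frobenius^ pr p⋆1≡0 k (x ^ p) (y ^ p) ⟩
    (x ^ p) ^ (p ℕ.^ k) + (y ^ p) ^ (p ℕ.^ k)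
      ≡⟨ cong₂ _+_ (^-assocʳ x p (p ℕ.^ k)) (^-assocʳ y p (p ℕ.^ k)) ⟩
    x ^ (p ℕ.* p ℕ.^ k) + y ^ (p ℕ.* p ℕ.^ k) ∎

  -- 1 + z + … + zʲ for z = x^(t+1).
  geometric : ∀ t j → Vec Carrier (j ℕ.* suc t)
  geometric t zero    = []
  geometric t (suc j) = 1# ∷ (replicate t 0# ++ geometric t j)

  -- The telescoping identity (z - 1)(1 + z + ... + zʲ) = zʲ⁺¹ - 1 with the negative terms moved
  -- across.
  geometric-sum : ∀ t j x → let z = x ^ suc t in
                  z * monic (geometric t j) x + 1# ≡ z ^ suc j + monic (geometric t j) x
  geometric-sum t zero    x = refl
  geometric-sum t (suc j) x = begin
    z * h + 1#                    ≡⟨ cong (λ w → z * w + 1#) h≡ ⟩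
    z * (1# + z * g) + 1#         ≡⟨ cong (λ w → z * w + 1#) (trans (+-comm 1# _) (geometric-sum t j x)) ⟩
    z * (z ^ suc j + g) + 1#
      ≡⟨ solve 4 (λ z w g o → z :* (w :+ g) :+ o := z :* w :+ (o :+ z :* g)) refl z (z ^ suc j) g 1# ⟩
    z * z ^ suc j + (1# + z * g)  ≡⟨ cong (z * z ^ suc j +_) h≡ ⟨
    z ^ suc (suc j) + h           ∎
    where
    z g h : Carrier
    z = x ^ suc t
    g = monic (geometric t j) x
    h = monic (geometric t (suc j)) x
    h≡ : h ≡ 1# + z * g
    h≡ = cong (1# +_) (trans (cong (x *_) (monic-shift t (geometric t j) x)) (sym (*-assoc x _ _)))

  -- The subfield of order s

  -- The enumeration `κ` makes the size s part of the structure, so that numbers written in base s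
  -- can encode coefficients.
  record Subfield (s : ℕ) : Set₁ where
    field
      _∈K         : Carrier → Set
      0∈K         : 0# ∈K
      1∈K         : 1# ∈K
      +-closed    : ∀ {x y} → x ∈K → y ∈K → (x + y) ∈K
      *-closed    : ∀ {x y} → x ∈K → y ∈K → (x * y) ∈K
      -‿closed    : ∀ {x} → x ∈K → (- x) ∈K
      ⁻¹-closed   : ∀ {x} → x ≢ 0# → x ∈K → (x ⁻¹) ∈K
      κ           : Fin s → Carrier
      κ∈K         : ∀ k → κ k ∈K
      κ-injective : ∀ {k l} → κ k ≡ κ l → k ≡ l
      κ-onto      : ∀ {x} → x ∈K → ∃ λ k → κ k ≡ x

  elements : List Carrier
  elements = tabulate elt

  elements-unique : Unique elements
  elements-unique = Unique.tabulate⁺ elt-injective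

  ∈-elements : ∀ x → x ∈ elements
  ∈-elements x = subst (_∈ elements) (elt-ix x) (∈-tabulate⁺ (ix x))

  module _ (t r : ℕ) (order≡ : order ≡ suc (suc t) ℕ.^ suc r) where
    private
      s : ℕ
      s = suc (suc t)

      fixed? : ∀ x → Dec (x ^ s ≡ x)
      fixed? x = x ^ s ≟ x

    fixed non-fixed : List Carrier
    fixed     = filter fixed? elements
    non-fixed = filter (¬? ∘ fixed?) elements

    #fixed≤ : length fixed ≤ s
    #fixed≤ = subst (length fixed ≤_) (cong (λ d → suc (suc d)) (ℕ.+-identityʳ t))
      (#roots≤degree cs (Unique.filter⁺ fixed? elements-unique) (All.map root (all-filter fixed? elements)))
      where
      -- The lower coefficients of xˢ - x: 0, then -1, then t zeros.
      cs : Vec Carrier (suc (suc (t ℕ.+ 0)))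
      cs = 0# ∷ - 1# ∷ (replicate t 0# ++ [])
      root : ∀ {x} → x ^ s ≡ x → monic cs x ≡ 0#
      root {x} x^s≡x = begin
        0# + x * (- 1# + x * monic (replicate t 0# ++ []) x) ≡⟨ +-identityˡ _ ⟩
        x * (- 1# + x * monic (replicate t 0# ++ []) x)
          ≡⟨ cong (λ w → x * (- 1# + x * w)) (trans (monic-shift t [] x) (*-identityʳ _)) ⟩
        x * (- 1# + x ^ suc t)         ≡⟨ distribˡ x _ _ ⟩
        x * - 1# + x ^ s               ≡⟨ cong₂ _+_ (trans (sym (-‿distribʳ-* x 1#)) (cong -_ (*-identityʳ x))) x^s≡x ⟩
        - x + x                        ≡⟨ -‿inverseˡ x ⟩
        0#                             ∎

    private
      -- Here M + 1 = 1 + s + ... + sʳ = (order - 1)/(s - 1). Hence `geometric t M` is the quotient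
      -- of x^order - x by xˢ - x, and its degree M(s - 1) equals order - s.
      M : ℕ
      M = ℕ.pred (geo s (suc r))

      order≡′ : order ≡ suc (suc t ℕ.* suc M)
      order≡′ = trans order≡ (trans (s^n≡1+[s-1]geo t (suc r))
        (cong (λ g → suc (suc t ℕ.* g)) (sym (ℕ.suc-pred (geo s (suc r)) {{ℕ.>-nonZero (geo>0 s r)}}))))

    -- If xˢ ≠ x, then x ≠ 0 and z = xˢ⁻¹ differs from 1, while `fermat` gives zᴹ⁺¹ = 1. The
    -- telescoping identity then reads z g = g, which forces g = 0.
    non-fixed-root : ∀ {x} → x ^ s ≢ x → monic (geometric t M) x ≡ 0#
    non-fixed-root {x} x^s≢x with monic (geometric t M) x ≟ 0#
    ... | yes eq = eq
    ... | no g≢0 = ⊥-elim (z≢1 (*-cancelʳ g≢0 (begin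
      z * g              ≡⟨ +-cancelʳ 1# _ _ (begin
        z * g + 1#       ≡⟨ geometric-sum t M x ⟩
        z ^ suc M + g    ≡⟨ cong (_+ g) z^≡1 ⟩
        1# + g           ≡⟨ +-comm 1# g ⟩
        g + 1#           ∎) ⟩
      g                  ≡⟨ *-identityˡ g ⟨
      1# * g             ∎)))
      where
      z g : Carrier
      z = x ^ suc t
      g = monic (geometric t M) x
      x≢0 : x ≢ 0#
      x≢0 refl = x^s≢x (zeroˡ _)
      z≢1 : z ≢ 1#
      z≢1 z≡1 = x^s≢x (trans (cong (x *_) z≡1) (*-identityʳ x))
      z^≡1 : z ^ suc M ≡ 1#
      z^≡1 = *-cancelˡ x≢0 (begin
        x * z ^ suc M                  ≡⟨ cong (x *_) (^-assocʳ x (suc t) (suc M)) ⟩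
        x ^ suc (suc t ℕ.* suc M)      ≡⟨ cong (x ^_) order≡′ ⟨
        x ^ order                      ≡⟨ fermat x ⟩
        x                              ≡⟨ *-identityʳ x ⟨
        x * 1#                         ∎)

    #non-fixed≤ : length non-fixed ≤ M ℕ.* suc t
    #non-fixed≤ = #roots≤degree (geometric t M) (Unique.filter⁺ (¬? ∘ fixed?) elements-unique)
      (All.map non-fixed-root (all-filter (¬? ∘ fixed?) elements))

    -- The two lists partition F, which has s + M(s - 1) elements. Since the second list has at most
    -- M(s - 1), the first has at least s.
    #fixed≡ : length fixed ≡ s
    #fixed≡ = ℕ.≤-antisym #fixed≤ (ℕ.+-cancelʳ-≤ (M ℕ.* suc t) s (length fixed)
      (ℕ.≤-trans (ℕ.≤-reflexive (begin
        s ℕ.+ M ℕ.* suc t                  ≡⟨ cong suc (ℕ.*-comm (suc M) (suc t)) ⟩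
        suc (suc t ℕ.* suc M)              ≡⟨ order≡′ ⟨
        order                              ≡⟨ length-tabulate elt ⟨
        length elements                    ≡⟨ length-filter-¬ fixed? elements ⟨
        length fixed ℕ.+ length non-fixed  ∎)) (ℕ.+-monoʳ-≤ (length fixed) #non-fixed≤)))

    fixed-subfield : (∀ x y → (x + y) ^ s ≡ x ^ s + y ^ s) → Subfield s
    fixed-subfield frob = record
      { _∈K         = λ x → x ^ s ≡ x
      ; 0∈K         = zeroˡ _
      ; 1∈K         = 1^ s
      ; +-closed    = λ {x} {y} x∈ y∈ → trans (frob x y) (cong₂ _+_ x∈ y∈)
      ; *-closed    = λ {x} {y} x∈ y∈ → trans (^-distrib-* x y s) (cong₂ _*_ x∈ y∈)
      -- Additivity applied to x and -x determines (-x)ˢ, with no case distinction on the parity of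
      -- s.
      ; -‿closed    = λ {x} x∈ → +-cancelˡ x _ _ (begin
          x + (- x) ^ s        ≡⟨ cong (_+ (- x) ^ s) x∈ ⟨
          x ^ s + (- x) ^ s    ≡⟨ frob x (- x) ⟨
          (x + - x) ^ s        ≡⟨ cong (_^ s) (-‿inverseʳ x) ⟩
          0# ^ s               ≡⟨ zeroˡ _ ⟩
          0#                   ≡⟨ -‿inverseʳ x ⟨
          x + - x              ∎)
      ; ⁻¹-closed   = λ {x} x≢0 x∈ → *-cancelˡ x≢0 (begin
          x * (x ⁻¹) ^ s       ≡⟨ cong (_* (x ⁻¹) ^ s) x∈ ⟨
          x ^ s * (x ⁻¹) ^ s   ≡⟨ ^-distrib-* x (x ⁻¹) s ⟨
          (x * x ⁻¹) ^ s       ≡⟨ cong (_^ s) (inverse x x≢0) ⟩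
          1# ^ s               ≡⟨ 1^ s ⟩
          1#                   ≡⟨ inverse x x≢0 ⟨
          x * x ⁻¹             ∎)
      ; κ           = λ k → lookup fixed (cast (sym #fixed≡) k)
      ; κ∈K         = λ k → proj₂ (∈-filter⁻ fixed? {xs = elements} (∈-lookup (cast (sym #fixed≡) k)))
      ; κ-injective = λ {k} {l} eq → Fin.toℕ-injective (begin
          toℕ k                        ≡⟨ Fin.toℕ-cast (sym #fixed≡) k ⟨
          toℕ (cast (sym #fixed≡) k)
            ≡⟨ cong toℕ (unique-lookup-injective (Unique.filter⁺ fixed? elements-unique) eq) ⟩
          toℕ (cast (sym #fixed≡) l)   ≡⟨ Fin.toℕ-cast (sym #fixed≡) l ⟩
          toℕ l                        ∎)
      ; κ-onto      = λ {x} x∈ → let x∈fixed = ∈-filter⁺ fixed? (∈-elements x) x∈ in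
          cast #fixed≡ (Any.index x∈fixed) ,
          trans (cong (lookup fixed) (Fin.cast-involutive (sym #fixed≡) #fixed≡ (Any.index x∈fixed)))
                (sym (lookup-index x∈fixed))
      }
      where
      1^ : ∀ n → 1# ^ n ≡ 1#
      1^ zero    = refl
      1^ (suc n) = trans (*-identityˡ _) (1^ n)

  subfield : ∀ {p} k r → Prime p → 1 < p ℕ.^ k → order ≡ (p ℕ.^ k) ℕ.^ suc r → Subfield (p ℕ.^ k)
  subfield {p} k r pr 1<s eq = by-size (p ℕ.^ k) 1<s eq (frobenius^ pr p⋆1≡0 k)
    where
    p⋆1≡0 : p ⋆ 1# ≡ 0#
    p⋆1≡0 = characteristic p (k ℕ.* suc r) (trans eq (ℕ.^-*-assoc p k (suc r)))
    -- Abstracting `p ^ k` to a variable allows it to be matched as t + 2.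
    by-size : ∀ s → 1 < s → order ≡ s ℕ.^ suc r → (∀ x y → (x + y) ^ s ≡ x ^ s + y ^ s) → Subfield s
    by-size (suc (suc t)) _ eq = fixed-subfield t r eq
    by-size 1 (s≤s ())

  -- Linear algebra over the subfield by counting

  module LinearAlgebra {s : ℕ} (1<s : 1 < s) (K : Subfield s) where
    open Subfield K

    -- The number i < sʳ, written in base s, gives the coefficients of us.
    comb : ∀ {r} → Fin (s ℕ.^ r) → Vec Carrier r → Carrier
    comb i []                = 0#
    comb {suc r} i (u ∷ us) = κ (quotient {s} (s ℕ.^ r) i) * u + comb (remainder {s} (s ℕ.^ r) i) us

    -- The witness is a number below sʳ rather than a list of scalars. Membership is thus decidable
    -- by finite search, and comparisons of dimension become injections between finite sets.
    record Span {r : ℕ} (us : Vec Carrier r) (x : Carrier) : Set where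
      constructor spanned
      field
        digits : Fin (s ℕ.^ r)
        value  : comb digits us ≡ x

    open Span

    -- This triangular form of independence fits families that grow at the front by one element
    -- outside the current span.
    Independent : ∀ {r} → Vec Carrier r → Set
    Independent []       = ⊤
    Independent (u ∷ us) = ¬ Span us u × Independent us

    span? : ∀ {r} (us : Vec Carrier r) x → Dec (Span us x)
    span? us x = map′ (λ (i , eq) → spanned i eq) (λ (spanned i eq) → i , eq) (Fin.any? λ i → comb i us ≟ x)

    span-∷ : ∀ {r u} {us : Vec Carrier r} {c y} → c ∈K → Span us y → Span (u ∷ us) (c * u + y)
    span-∷ {r} {u} {us} c∈K (spanned i refl) with κ-onto c∈K
    ... | k , refl = spanned (combine k i) $ cong₂ (λ k i → κ k * u + comb i us)
      (cong proj₁ (Fin.remQuot-combine k i)) (cong proj₂ (Fin.remQuot-combine {s} k i))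

    span-0 : ∀ {r} (us : Vec Carrier r) → Span us 0#
    span-0 []       = spanned zero refl
    span-0 (u ∷ us) = subst (Span (u ∷ us)) (trans (+-identityʳ _) (zeroˡ u)) (span-∷ 0∈K (span-0 us))

    span-+ : ∀ {r} (us : Vec Carrier r) {x y} → Span us x → Span us y → Span us (x + y)
    span-+ []       (spanned _ refl) (spanned _ refl) = spanned zero $ sym (+-identityˡ 0#)
    span-+ (u ∷ us) (spanned i refl) (spanned j refl) = subst (Span (u ∷ us))
      (solve 5 (λ c d u x y → (c :+ d) :* u :+ (x :+ y) := c :* u :+ x :+ (d :* u :+ y)) refl _ _ u _ _)
      (span-∷ (+-closed (κ∈K _) (κ∈K _)) (span-+ us (spanned _ refl) (spanned _ refl)))

    span-* : ∀ {r} (us : Vec Carrier r) {c x} → c ∈K → Span us x → Span us (c * x)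
    span-* []       {c} c∈K (spanned _ refl) = spanned zero $ sym (zeroʳ c)
    span-* (u ∷ us) {c} c∈K (spanned i refl) = subst (Span (u ∷ us))
      (solve 4 (λ c d u x → c :* d :* u :+ c :* x := c :* (d :* u :+ x)) refl c _ u _)
      (span-∷ (*-closed c∈K (κ∈K _)) (span-* us c∈K (spanned _ refl)))

    span-- : ∀ {r} (us : Vec Carrier r) {x y} → Span us x → Span us y → Span us (x - y)
    span-- us {x} {y} x∈ y∈ = span-+ us x∈ (subst (Span us) (trans (sym (-‿distribˡ-* 1# y)) (cong -_ (*-identityˡ y)))
      (span-* us (-‿closed 1∈K) y∈))

    span-trans : ∀ {r t} {us : Vec Carrier r} (ws : Vec Carrier t) →
                 VecAll.All (Span us) ws → ∀ i → Span us (comb i ws)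
    span-trans {us = us} []       _          i = span-0 us
    span-trans {us = us} (w ∷ ws) (w∈ VecAll.∷ ws∈) i = span-+ us (span-* us (κ∈K _) w∈) (span-trans ws ws∈ _)

    comb-map : ∀ {r} b i (us : Vec Carrier r) → comb i (map (b *_) us) ≡ b * comb i us
    comb-map b i []       = sym (zeroʳ b)
    comb-map b i (u ∷ us) = trans (cong (_ +_) (comb-map b _ us))
      (solve 4 (λ c b u x → c :* (b :* u) :+ b :* x := b :* (c :* u :+ x)) refl _ b u _)

    isolate : ∀ {c c′ u y y′} → c * u + y ≡ c′ * u + y′ → (c - c′) * u ≡ y′ - y
    isolate {c} {c′} {u} {y} {y′} eq = +-cancelʳ (c′ * u + y) _ _ (begin
      (c - c′) * u + (c′ * u + y)
        ≡⟨ solve 4 (λ d c u y → d :* u :+ (c :* u :+ y) := (d :+ c) :* u :+ y) refl (c - c′) c′ u y ⟩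
      (c - c′ + c′) * u + y       ≡⟨ cong (λ z → z * u + y) (x-y+y≡x c c′) ⟩
      c * u + y                   ≡⟨ eq ⟩
      c′ * u + y′                 ≡⟨ cong (c′ * u +_) (x-y+y≡x y′ y) ⟨
      c′ * u + (y′ - y + y)
        ≡⟨ solve 3 (λ v d y → v :+ (d :+ y) := d :+ (v :+ y)) refl (c′ * u) (y′ - y) y ⟩
      y′ - y + (c′ * u + y)       ∎)

    -- Equal leading coefficients cancel. Distinct ones differ by some d ≠ 0 in K; dividing by d in
    -- `isolate` would place `u` in the span of the remaining elements.
    comb-injective : ∀ {r} (us : Vec Carrier r) → Independent us → ∀ {i j} → comb i us ≡ comb j us → i ≡ j
    comb-injective []       _ {zero} {zero} _ = refl
    comb-injective {suc r} (u ∷ us) (u∉ , ind) {i} {j} eq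
      with κ (quotient {s} (s ℕ.^ r) i) ≟ κ (quotient {s} (s ℕ.^ r) j)
    ... | yes c≡c′ = begin
      i                                     ≡⟨ Fin.combine-remQuot {s} (s ℕ.^ r) i ⟨
      combine (quotient {s} (s ℕ.^ r) i) (remainder {s} (s ℕ.^ r) i)
        ≡⟨ cong₂ combine (κ-injective c≡c′)
             (comb-injective us ind (+-cancelˡ _ _ _ (trans (cong (λ c → c * u + comb (remainder {s} (s ℕ.^ r) i) us) (sym c≡c′)) eq))) ⟩
      combine (quotient {s} (s ℕ.^ r) j) (remainder {s} (s ℕ.^ r) j)
                                            ≡⟨ Fin.combine-remQuot {s} (s ℕ.^ r) j ⟩
      j                                     ∎
    ... | no  c≢c′ = ⊥-elim (u∉ (subst (Span us) (trans (cong (d ⁻¹ *_) (sym (isolate eq))) (x⁻¹[xy]≡y d≢0 u))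
      (span-* us (⁻¹-closed d≢0 (+-closed (κ∈K _) (-‿closed (κ∈K _)))) (span-- us (spanned _ refl) (spanned _ refl)))))
      where
      d : Carrier
      d = κ (quotient {s} (s ℕ.^ r) i) - κ (quotient {s} (s ℕ.^ r) j)
      d≢0 : d ≢ 0#
      d≢0 = c≢c′ ∘ x-y≡0⇒x≡y

    ^-cancel-≤ : ∀ {i j} → s ℕ.^ i ≤ s ℕ.^ j → i ≤ j
    ^-cancel-≤ {i} {j} le = ℕ.≮⇒≥ λ j<i → ℕ.<⇒≱ (ℕ.^-monoʳ-< s 1<s j<i) le

    -- The sᵗ combinations of `ws` are distinct and lie in the span of `us`, which has at most sʳ
    -- elements.
    steinitz : ∀ {r t} (us : Vec Carrier r) (ws : Vec Carrier t) → Independent ws →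
               VecAll.All (Span us) ws → t ≤ r
    steinitz us ws ind ws∈ = ^-cancel-≤ (Fin.injective⇒≤ {f = λ i → digits (span-trans ws ws∈ i)} λ {i} {j} eq →
      comb-injective ws ind (trans (sym (value (span-trans ws ws∈ i)))
        (trans (cong (λ k → comb k us) eq) (value (span-trans ws ws∈ j)))))

    all⊎counterexample : ∀ {P : Carrier → Set} → (∀ x → Dec (P x)) → ∀ {t} (ws : Vec Carrier t) →
                         VecAll.All P ws ⊎ ∃ λ w → w ∈ toList ws × ¬ P w
    all⊎counterexample P? [] = inj₁ VecAll.[]
    all⊎counterexample P? (w ∷ ws) with P? w | all⊎counterexample P? ws
    ... | no ¬pw | _                    = inj₂ (w , here refl , ¬pw)
    ... | yes pw | inj₁ all             = inj₁ (pw VecAll.∷ all)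
    ... | yes pw | inj₂ (v , v∈ , ¬pv)  = inj₂ (v , there v∈ , ¬pv)

    -- Otherwise scaling by a⁻¹ would place all t independent elements of `ws` in the span of the r
    -- < t elements `a ⁻¹ * u`, against `steinitz`.
    exchange : ∀ {r t a} → a ≢ 0# → r < t → (us : Vec Carrier r) (ws : Vec Carrier t) → Independent ws →
               ∃ λ w → w ∈ toList ws × ¬ Span us (a * w)
    exchange {a = a} a≢0 r<t us ws ind with all⊎counterexample (λ w → span? us (a * w)) ws
    ... | inj₂ found = found
    ... | inj₁ all   = ⊥-elim (ℕ.<⇒≱ r<t (steinitz (map (a ⁻¹ *_) us) ws ind
      (VecAll.map (λ {w} (spanned i eq) → spanned i (begin
        comb i (map (a ⁻¹ *_) us) ≡⟨ comb-map (a ⁻¹) i us ⟩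
        a ⁻¹ * comb i us          ≡⟨ cong (a ⁻¹ *_) eq ⟩
        a ⁻¹ * (a * w)            ≡⟨ x⁻¹[xy]≡y a≢0 w ⟩
        w                         ∎)) all)))

    module _ {m : ℕ} (order≡ : order ≡ s ℕ.^ m) where

      -- If `us` spanned F, its at most sʳ combinations would have to cover sᵐ elements.
      escape : ∀ {r} → r < m → (us : Vec Carrier r) → ∃ λ u → ¬ Span us u
      escape r<m us with Fin.¬∀⟶∃¬ order (Span us ∘ elt) (span? us ∘ elt) (λ spans →
        ℕ.<⇒≱ r<m (^-cancel-≤ (subst (_≤ _) order≡ (Fin.injective⇒≤ {f = digits ∘ spans} λ {i} {j} eq →
          elt-injective (trans (sym (value (spans i))) (trans (cong (λ k → comb k us) eq) (value (spans j))))))))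
      ... | i , ∉ = elt i , ∉

      independent-family : ∀ r → r ≤ m → Σ (Vec Carrier r) Independent
      independent-family zero    _   = [] , _
      independent-family (suc r) r<m with independent-family r (ℕ.<⇒≤ r<m)
      ... | us , ind with escape r<m us
      ... | u , u∉ = u ∷ us , u∉ , ind

      -- An element outside the span would extend the family to m + 1 independent elements, with
      -- sᵐ⁺¹ distinct combinations inside a field of order sᵐ.
      basis-spans : (us : Vec Carrier m) → Independent us → ∀ x → Span us x
      basis-spans us ind x with span? us x
      ... | yes x∈ = x∈
      ... | no  x∉ = ⊥-elim (ℕ.1+n≰n (^-cancel-≤ {suc m} {m} (subst (_ ≤_) order≡
        (Fin.injective⇒≤ {f = λ i → ix (comb i (x ∷ us))} (comb-injective (x ∷ us) (x∉ , ind) ∘ ix-injective)))))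

-- Triangular numbers and the size estimate

triangle : ℕ → ℕ
triangle zero    = 0
triangle (suc k) = suc k ℕ.+ triangle k

2*triangle : ∀ k → 2 ℕ.* triangle k ≡ k ℕ.* suc k
2*triangle zero    = refl
2*triangle (suc k) = begin
  2 ℕ.* (suc k ℕ.+ triangle k)         ≡⟨ ℕ.*-distribˡ-+ 2 (suc k) (triangle k) ⟩
  2 ℕ.* suc k ℕ.+ 2 ℕ.* triangle k     ≡⟨ cong (2 ℕ.* suc k ℕ.+_) (2*triangle k) ⟩
  2 ℕ.* suc k ℕ.+ k ℕ.* suc k          ≡⟨ ℕ.*-distribʳ-+ (suc k) 2 k ⟨
  (2 ℕ.+ k) ℕ.* suc k                  ≡⟨ ℕ.*-comm (2 ℕ.+ k) (suc k) ⟩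
  suc k ℕ.* suc (suc k)                ∎

-- Both sides are multiplied by 2(s - 1) to clear denominators. The affine parts then agree exactly,
-- and the points at infinity contribute 2(sⁿ - 1), which is at most ρ(ρ + 1) times itself.
size-bound : ∀ {s ρ n ℓ} → 1 < s → 0 < ρ → ℓ ≤ triangle (suc ρ) ℕ.* s ℕ.^ n ℕ.+ geo s n →
             2 ℕ.* (s ∸ 1) ℕ.* ℓ ≤ (ρ ℕ.+ 1) ℕ.* (ρ ℕ.+ 2) ℕ.* (s ∸ 1) ℕ.* s ℕ.^ n
                                   ℕ.+ 2 ℕ.* ρ ℕ.* (ρ ℕ.+ 1) ℕ.* (s ℕ.^ n ∸ 1)
size-bound {1} (s≤s ())
size-bound {s@(suc (suc t))} {ρ@(suc _)} {n} {ℓ} _ _ ℓ≤ = ℕ.≤-trans (ℕ.*-monoʳ-≤ (2 ℕ.* suc t) ℓ≤)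
  (ℕ.≤-trans (ℕ.≤-reflexive expand) (ℕ.+-monoʳ-≤ ((ρ ℕ.+ 1) ℕ.* (ρ ℕ.+ 2) ℕ.* suc t ℕ.* X) (ℕ.≤-trans (ℕ.≤-reflexive (sym (ℕ.*-identityˡ (2 ℕ.* (X ∸ 1)))))
    (ℕ.≤-trans (ℕ.*-monoˡ-≤ (2 ℕ.* (X ∸ 1)) {1} {ρ ℕ.* (ρ ℕ.+ 1)} (s≤s z≤n)) (ℕ.≤-reflexive regroup)))))
  where
  open ℕSolver.+-*-Solver
  X G T : ℕ
  X = s ℕ.^ n
  G = geo s n
  T = triangle (suc ρ)

  2T≡ : 2 ℕ.* T ≡ (ρ ℕ.+ 1) ℕ.* (ρ ℕ.+ 2)
  2T≡ = trans (2*triangle (suc ρ)) (cong₂ ℕ._*_ (ℕ.+-comm 1 ρ) (ℕ.+-comm 2 ρ))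

  expand : 2 ℕ.* suc t ℕ.* (T ℕ.* X ℕ.+ G) ≡
           (ρ ℕ.+ 1) ℕ.* (ρ ℕ.+ 2) ℕ.* suc t ℕ.* X ℕ.+ 2 ℕ.* (X ∸ 1)
  expand = begin
    2 ℕ.* suc t ℕ.* (T ℕ.* X ℕ.+ G)
      ≡⟨ solve 4 (λ t T X G → con 2 :* t :* (T :* X :+ G) := con 2 :* T :* t :* X :+ con 2 :* (t :* G))
           refl (suc t) T X G ⟩
    2 ℕ.* T ℕ.* suc t ℕ.* X ℕ.+ 2 ℕ.* (suc t ℕ.* G)
      ≡⟨ cong₂ (λ a b → a ℕ.* suc t ℕ.* X ℕ.+ 2 ℕ.* b) 2T≡ (cong ℕ.pred (sym (s^n≡1+[s-1]geo t n))) ⟩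
    (ρ ℕ.+ 1) ℕ.* (ρ ℕ.+ 2) ℕ.* suc t ℕ.* X ℕ.+ 2 ℕ.* (X ∸ 1) ∎

  regroup : ρ ℕ.* (ρ ℕ.+ 1) ℕ.* (2 ℕ.* (X ∸ 1)) ≡ 2 ℕ.* ρ ℕ.* (ρ ℕ.+ 1) ℕ.* (X ∸ 1)
  regroup = solve 3 (λ r r′ x → r :* r′ :* (con 2 :* x) := con 2 :* r :* r′ :* x) refl ρ (ρ ℕ.+ 1) (X ∸ 1)

-- Lists of vectors up to proportionality

module PointSets (F : FiniteField) (N : ℕ) where
  open Field F
  open Projective F N renaming (Vec to Point)

  proportional? : ∀ u v → Dec (Proportional u v)
  proportional? u v = map′ (λ (i , c≢0 , eq) → elt i , c≢0 , eq)
    (λ (c , c≢0 , eq) → ix c , c≢0 ∘ trans (sym (elt-ix c)) , λ j → trans (eq j) (cong (_* v j) (sym (elt-ix c))))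
    (Fin.any? λ i → ¬? (elt i ≟ 0#) ×-dec Fin.all? λ j → u j ≟ elt i * v j)

  _IsMultipleIn_ : Point → List Point → Set
  v IsMultipleIn S = Σ Carrier λ c → Σ Point λ w → w ∈ S × (∀ i → v i ≡ c * w i)

  -- The construction repeats points: (eᵢ , b x) with x = 0 is the same for every b. Pruning keeps
  -- one representative per projective point. `covers` lets linear combinations be rewritten in the
  -- pruned list, and `⊆-original` lets properties of the members be inherited.
  record Reduction (L : List Point) : Set where
    field
      reduced    : List Point
      isPointSet : IsPointSet reduced
      shorter    : length reduced ≤ length L
      ⊆-original : ∀ {v} → v ∈ reduced → v ∈ L
      covers     : ∀ {v} → v ∈ L → v IsMultipleIn reduced

  weaken : ∀ {v u S} → v IsMultipleIn S → v IsMultipleIn (u ∷ S)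
  weaken (c , w , w∈ , eq) = c , w , there w∈ , eq

  reduce : ∀ L → All NonZero L → Reduction L
  reduce [] [] = record
    { reduced = [] ; isPointSet = [] , [] ; shorter = z≤n ; ⊆-original = λ () ; covers = λ () }
  reduce (v ∷ L) (v≢0 ∷ L≢0) with reduce L L≢0
  ... | R with Any.any? (proportional? v) (Reduction.reduced R)
  ... | yes prop = record
    { reduced    = reduced
    ; isPointSet = isPointSet
    ; shorter    = ℕ.m≤n⇒m≤1+n shorter
    ; ⊆-original = there ∘ ⊆-original
    ; covers     = λ { (here refl) → let w , w∈ , c , _ , eq = find prop in c , w , w∈ , eq
                     ; (there u∈)  → covers u∈ }
    }
    where open Reduction R
  ... | no ¬prop = record
    { reduced    = v ∷ reduced
    ; isPointSet = v≢0 ∷ proj₁ isPointSet , ¬Any⇒All¬ reduced ¬prop ∷ proj₂ isPointSet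
    ; shorter    = s≤s shorter
    ; ⊆-original = λ { (here refl) → here refl ; (there u∈) → there (⊆-original u∈) }
    ; covers     = λ { (here refl) → 1# , v , here refl , λ i → sym (*-identityˡ (v i))
                     ; (there u∈)  → weaken (covers u∈) }
    }
    where open Reduction R

  lincomb-support : ∀ xs i → lincomb xs i ≢ 0# → Any (λ v → v i ≢ 0#) (points xs)
  lincomb-support []             i ≢0 = ⊥-elim (≢0 refl)
  lincomb-support ((c , v) ∷ xs) i ≢0 with v i ≟ 0#
  ... | no  vi≢0 = here vi≢0
  ... | yes vi≡0 = there (lincomb-support xs i λ eq → ≢0 (trans (cong₂ (λ a b → c * a + b) vi≡0 eq)
                     (trans (+-identityʳ _) (zeroʳ c))))

  length-points : ∀ xs → length (points xs) ≡ length xs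
  length-points []       = refl
  length-points (_ ∷ xs) = cong suc (length-points xs)

-- The candidate set and its size

module Construction (F : FiniteField) (ρ n′ : ℕ) {s : ℕ} (1<s : 1 < s) (K : Field.Subfield F s)
                    (order≡ : FiniteField.order F ≡ s ℕ.^ suc ρ) where
  open Field F
  open Subfield K
  open LinearAlgebra 1<s K

  m n : ℕ
  m = suc ρ
  n = suc n′

  -- With the dimension in this form, the number of coordinates is m + n by computation, so vectors
  -- split into a head of length m and a tail of length n.
  open Projective F (ρ ℕ.+ n) renaming (Vec to Point)
  open PointSets F (ρ ℕ.+ n)

  unit : Fin m → Fin m → Carrier
  unit i j with i Fin.≟ j
  ... | yes _ = 1#
  ... | no  _ = 0#

  unit-≡ : ∀ i → unit i i ≡ 1#
  unit-≡ i with i Fin.≟ i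
  ... | yes _  = refl
  ... | no i≢i = ⊥-elim (i≢i refl)

  unit-≢ : ∀ {i j} → i ≢ j → unit i j ≡ 0#
  unit-≢ {i} {j} i≢j with i Fin.≟ j
  ... | yes i≡j = ⊥-elim (i≢j i≡j)
  ... | no  _   = refl

  tuple : ∀ {d} → Fin (s ℕ.^ d) → Fin d → Carrier
  tuple c l = κ (finToFun c l)

  tuple-onto : ∀ {d} (x : Fin d → Fin s) l → tuple (funToFin x) l ≡ κ (x l)
  tuple-onto x l = cong κ (Fin.finToFun-funToFin x l)

  affine : Fin m → Carrier → Fin (s ℕ.^ n) → Point
  affine i b c = unit i Vector.++ λ l → b * tuple c l

  infinite : (Fin n → Carrier) → Point
  infinite y = (λ (_ : Fin m) → 0#) Vector.++ y

  -- The points of PG(d-1,s), normalised so that the first nonzero coordinate is 1.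
  normalised : ∀ d → List (Fin d → Carrier)
  normalised zero    = []
  normalised (suc d) = List.map (λ c → 1# Vector.∷ tuple {d} c) (allFin (s ℕ.^ d))
                       List.++ List.map (0# Vector.∷_) (normalised d)

  length-normalised : ∀ d → length (normalised d) ≡ geo s d
  length-normalised zero    = refl
  length-normalised (suc d) = trans (length-++ (List.map (λ c → 1# Vector.∷ tuple {d} c) (allFin (s ℕ.^ d))))
    (cong₂ ℕ._+_ (trans (length-map _ (allFin (s ℕ.^ d))) (length-tabulate (λ i → i)))
                 (trans (length-map _ (normalised d)) (length-normalised d)))

  normalised-≢0 : ∀ d → All (λ y → ∃ λ l → y l ≢ 0#) (normalised d)
  normalised-≢0 zero    = []
  normalised-≢0 (suc d) = ++⁺ (map⁺ (All.tabulate λ _ → zero , 0≢1 ∘ sym))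
    (map⁺ (All.map (λ (l , yl≢0) → suc l , yl≢0) (normalised-≢0 d)))

  normalise : ∀ d (x : Fin (suc d) → Fin s) →
              ∃ λ c → ∃ λ y → y ∈ normalised (suc d) × (∀ l → κ (x l) ≡ c * y l)
  normalise d x with κ (x zero) ≟ 0#
  ... | no c≢0 = c , (1# Vector.∷ tuple (funToFin x′)) , ∈-++⁺ˡ (∈-map⁺ _ (∈-allFin (funToFin x′))) , λ
    { zero    → sym (*-identityʳ c)
    ; (suc l) → sym (begin
        c * tuple (funToFin x′) l         ≡⟨ cong (c *_) (tuple-onto x′ l) ⟩
        c * κ (x′ l)                      ≡⟨ cong (c *_) (proj₂ (ratio l)) ⟩
        c * (c ⁻¹ * κ (x (suc l)))        ≡⟨ x[x⁻¹y]≡y c≢0 _ ⟩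
        κ (x (suc l))                     ∎) }
    where
    c : Carrier
    c = κ (x zero)
    ratio : ∀ l → ∃ λ k → κ k ≡ c ⁻¹ * κ (x (suc l))
    ratio l = κ-onto (*-closed (⁻¹-closed c≢0 (κ∈K _)) (κ∈K _))
    x′ : Fin d → Fin s
    x′ = proj₁ ∘ ratio
  -- The zero vector is 0 times any normalised point, so the first one in the list serves.
  normalise zero    x | yes x₀≡0 = 0# , _ , here refl , λ { zero → trans x₀≡0 (sym (zeroˡ _)) }
  normalise (suc d) x | yes x₀≡0 with normalise d (x ∘ suc)
  ... | c , y , y∈ , eq = c , (0# Vector.∷ y) , ∈-++⁺ʳ _ (∈-map⁺ (0# Vector.∷_) y∈) , λ
    { zero    → trans x₀≡0 (sym (zeroʳ c))
    ; (suc l) → eq l }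

  -- Position k gets k + 1 multipliers, one more than the number of basis elements chosen before it,
  -- which is what `exchange` demands.
  multipliers : ∀ k → k < m → Vec Carrier (suc k)
  multipliers k k<m = proj₁ (independent-family order≡ (suc k) k<m)

  multipliers-independent : ∀ k (k<m : k < m) → Independent (multipliers k k<m)
  multipliers-independent k k<m = proj₂ (independent-family order≡ (suc k) k<m)

  translates : Fin m → Carrier → List Point
  translates i b = List.map (affine i b) (allFin (s ℕ.^ n))

  block : ∀ k → k < m → List Point
  block k k<m = concatMap (translates (fromℕ< k<m)) (toList (multipliers k k<m))

  affinePoints : ∀ k → k ≤ m → List Point
  affinePoints zero    _   = []
  affinePoints (suc k) k<m = block k k<m List.++ affinePoints k (ℕ.<⇒≤ k<m)

  allPoints : List Point
  allPoints = affinePoints m ℕ.≤-refl List.++ List.map infinite (normalised n)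

  length-block : ∀ k k<m → length (block k k<m) ≡ suc k ℕ.* s ℕ.^ n
  length-block k k<m = go (multipliers k k<m)
    where
    go : ∀ {t} (bs : Vec Carrier t) →
         length (concatMap (translates (fromℕ< k<m)) (toList bs)) ≡ t ℕ.* s ℕ.^ n
    go []       = refl
    go (b ∷ bs) = trans (length-++ (translates (fromℕ< k<m) b))
      (cong₂ ℕ._+_ (trans (length-map _ (allFin (s ℕ.^ n))) (length-tabulate (λ i → i))) (go bs))

  length-affinePoints : ∀ k k≤m → length (affinePoints k k≤m) ≡ triangle k ℕ.* s ℕ.^ n
  length-affinePoints zero    _   = refl
  length-affinePoints (suc k) k<m = begin
    length (block k k<m List.++ affinePoints k _)           ≡⟨ length-++ (block k k<m) ⟩
    length (block k k<m) ℕ.+ length (affinePoints k _)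
      ≡⟨ cong₂ ℕ._+_ (length-block k k<m) (length-affinePoints k _) ⟩
    suc k ℕ.* s ℕ.^ n ℕ.+ triangle k ℕ.* s ℕ.^ n            ≡⟨ ℕ.*-distribʳ-+ (s ℕ.^ n) (suc k) (triangle k) ⟨
    triangle (suc k) ℕ.* s ℕ.^ n                            ∎

  length-allPoints : length allPoints ≡ triangle m ℕ.* s ℕ.^ n ℕ.+ geo s n
  length-allPoints = trans (length-++ (affinePoints m _)) (cong₂ ℕ._+_ (length-affinePoints m _)
    (trans (length-map infinite (normalised n)) (length-normalised n)))

  block⊆affinePoints : ∀ {v} j (j<m : j < m) k k≤m → j < k → v ∈ block j j<m → v ∈ affinePoints k k≤m
  block⊆affinePoints {v} j j<m (suc k) k<m (s≤s j≤k) v∈ with ℕ.m≤n⇒m<n∨m≡n j≤k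
  ... | inj₁ j<k  = ∈-++⁺ʳ (block k k<m) (block⊆affinePoints j j<m k _ j<k v∈)
  -- `block` carries the proof of its bound, so two proofs of the same inequality have to be
  -- identified.
  ... | inj₂ refl = ∈-++⁺ˡ (subst (λ lt → v ∈ block j lt) (ℕ.≤-irrelevant j<m k<m) v∈)

  affine∈ : ∀ k (k<m : k < m) b c → b ∈ toList (multipliers k k<m) → affine (fromℕ< k<m) b c ∈ allPoints
  affine∈ k k<m b c b∈ = ∈-++⁺ˡ (block⊆affinePoints k k<m m ℕ.≤-refl k<m
    (∈-concatMap⁺ _ (lose b∈ (∈-map⁺ _ (∈-allFin c)))))

  infinite∈ : ∀ {y} → y ∈ normalised n → infinite y ∈ allPoints
  infinite∈ y∈ = ∈-++⁺ʳ (affinePoints m _) (∈-map⁺ infinite y∈)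

  Light : Point → Set
  Light v = ∀ (i j : Fin m) → v (i ↑ˡ n) ≢ 0# → v (j ↑ˡ n) ≢ 0# → i ≡ j

  affine-light : ∀ i b c → Light (affine i b c)
  affine-light i b c j k j≢0 k≢0 = trans (sym (at j j≢0)) (at k k≢0)
    where
    at : ∀ (j : Fin m) → affine i b c (j ↑ˡ n) ≢ 0# → i ≡ j
    at j ≢0 with i Fin.≟ j
    ... | yes i≡j = i≡j
    ... | no  i≢j = ⊥-elim (≢0 (trans (lookup-++ˡ (unit i) _ j) (unit-≢ i≢j)))

  affine-≢0 : ∀ i b c → NonZero (affine i b c)
  affine-≢0 i b c ≡0 = 0≢1 (trans (sym (≡0 (i ↑ˡ n))) (trans (lookup-++ˡ (unit i) _ i) (unit-≡ i)))

  infinite-light : ∀ y → Light (infinite y)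
  infinite-light y i j i≢0 = ⊥-elim (i≢0 (lookup-++ˡ (λ (_ : Fin m) → 0#) y i))

  infinite-≢0 : ∀ {y l} → y l ≢ 0# → NonZero (infinite y)
  infinite-≢0 {y} {l} yl≢0 ≡0 = yl≢0 (trans (sym (lookup-++ʳ (λ (_ : Fin m) → 0#) y l)) (≡0 (m ↑ʳ l)))

  All-affinePoints : ∀ {Q : Point → Set} → (∀ i b c → Q (affine i b c)) → ∀ k k≤m → All Q (affinePoints k k≤m)
  All-affinePoints q zero    _   = []
  All-affinePoints q (suc k) k<m =
    ++⁺ (concat⁺ (map⁺ {xs = toList (multipliers k k<m)} {f = translates (fromℕ< k<m)} (All.tabulate λ {b} _ → map⁺ (All.tabulate λ {c} _ → q (fromℕ< k<m) b c))))
        (All-affinePoints q k _)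

  allPoints-≢0 : All NonZero allPoints
  allPoints-≢0 = ++⁺ (All-affinePoints affine-≢0 m _)
    (map⁺ (All.map (λ (_ , yl≢0) → infinite-≢0 yl≢0) (normalised-≢0 n)))

  allPoints-light : All Light allPoints
  allPoints-light = ++⁺ (All-affinePoints affine-light m _) (map⁺ (All.tabulate λ {y} _ → infinite-light y))

  -- Saturation by a greedy choice of a K-basis

  open Reduction (reduce allPoints allPoints-≢0) public renaming (reduced to S)

  -- A multiple of a single point of `S` equals (a eᵢ , u x). The scalar `u` is fixed before x,
  -- because the tail of the target can be expanded only once the whole basis is known.
  Term : Fin m → Carrier → Carrier → Set
  Term i a u = ∀ (x : Fin n → Fin s) → Σ Carrier λ c → Σ Point λ v → v ∈ S ×
    (∀ j → c * v (j ↑ˡ n) ≡ a * unit i j) × (∀ l → c * v (m ↑ʳ l) ≡ u * κ (x l))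

  next : ∀ k (k<m : k < m) a (us : Vec Carrier k) → ∃ λ u → ¬ Span us u × Term (fromℕ< k<m) a u
  next k k<m a us with a ≟ 0#
  ... | no a≢0 with exchange a≢0 (ℕ.n<1+n k) us (multipliers k k<m) (multipliers-independent k k<m)
  ...   | b , b∈ , ab∉ = a * b , ab∉ , term
    where
    i : Fin m
    i = fromℕ< k<m
    term : Term i a (a * b)
    term x with covers (affine∈ k k<m b (funToFin x) b∈)
    -- `S` may contain only a multiple `v` of the affine point; the factor `c` corrects for this.
    ... | c , v , v∈ , eq = a * c , v , v∈ , (λ j → begin
        a * c * v (j ↑ˡ n)     ≡⟨ *-assoc a c _ ⟩
        a * (c * v (j ↑ˡ n))   ≡⟨ cong (a *_) (eq (j ↑ˡ n)) ⟨
        a * affine i b (funToFin x) (j ↑ˡ n)   ≡⟨ cong (a *_) (lookup-++ˡ (unit i) _ j) ⟩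
        a * unit i j           ∎) , (λ l → begin
        a * c * v (m ↑ʳ l)     ≡⟨ *-assoc a c _ ⟩
        a * (c * v (m ↑ʳ l))   ≡⟨ cong (a *_) (eq (m ↑ʳ l)) ⟨
        a * affine i b (funToFin x) (m ↑ʳ l)   ≡⟨ cong (a *_) (lookup-++ʳ (unit i) _ l) ⟩
        a * (b * tuple (funToFin x) l)         ≡⟨ cong (λ z → a * (b * z)) (tuple-onto x l) ⟩
        a * (b * κ (x l))      ≡⟨ *-assoc a b _ ⟨
        a * b * κ (x l)        ∎)
  next k k<m a us | yes a≡0 with escape order≡ k<m us
  ... | u , u∉ = u , u∉ , term
    where
    term : Term (fromℕ< k<m) a u
    term x with normalise n′ x
    ... | d , y , y∈ , x≡dy with covers (infinite∈ y∈)
    -- `d` undoes the normalisation of x, and `c` passes from the representative `v` in `S` to the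
    -- point at infinity.
    ... | c , v , v∈ , eq = u * (d * c) , v , v∈ , (λ j → begin
        u * (d * c) * v (j ↑ˡ n)    ≡⟨ regroup (v (j ↑ˡ n)) ⟩
        u * (d * (c * v (j ↑ˡ n)))  ≡⟨ cong (λ z → u * (d * z)) (eq (j ↑ˡ n)) ⟨
        u * (d * infinite y (j ↑ˡ n))  ≡⟨ cong (λ z → u * (d * z)) (lookup-++ˡ (λ (_ : Fin m) → 0#) y j) ⟩
        u * (d * 0#)                ≡⟨ cong (u *_) (zeroʳ d) ⟩
        u * 0#                      ≡⟨ zeroʳ u ⟩
        0#                          ≡⟨ zeroˡ _ ⟨
        0# * unit (fromℕ< k<m) j    ≡⟨ cong (_* unit (fromℕ< k<m) j) a≡0 ⟨
        a * unit (fromℕ< k<m) j     ∎) , (λ l → begin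
        u * (d * c) * v (m ↑ʳ l)    ≡⟨ regroup (v (m ↑ʳ l)) ⟩
        u * (d * (c * v (m ↑ʳ l)))  ≡⟨ cong (λ z → u * (d * z)) (eq (m ↑ʳ l)) ⟨
        u * (d * infinite y (m ↑ʳ l))  ≡⟨ cong (λ z → u * (d * z)) (lookup-++ʳ (λ (_ : Fin m) → 0#) y l) ⟩
        u * (d * y l)               ≡⟨ cong (u *_) (x≡dy l) ⟨
        u * κ (x l)                 ∎)
      where
      regroup : ∀ z → u * (d * c) * z ≡ u * (d * (c * z))
      regroup z = trans (*-assoc u _ z) (cong (u *_) (*-assoc d c z))

  -- The state after k greedy steps. The first k head coordinates are correct, the others still
  -- vanish, and the coefficients `D` of the tail remain free, to be supplied once the basis is
  -- complete.
  record Partial (a : Fin m → Carrier) (k : ℕ) : Set where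
    field
      us          : Vec Carrier k
      independent : Independent us
      terms       : (Fin n → Fin (s ℕ.^ k)) → List (Carrier × Point)
      #terms      : ∀ D → length (terms D) ≡ k
      terms∈S     : ∀ D → All (_∈ S) (points (terms D))
      head-<      : ∀ D (i : Fin m) → toℕ i < k → lincomb (terms D) (i ↑ˡ n) ≡ a i
      head-≥      : ∀ D (i : Fin m) → k ≤ toℕ i → lincomb (terms D) (i ↑ˡ n) ≡ 0#
      tail        : ∀ D l → lincomb (terms D) (m ↑ʳ l) ≡ comb (D l) us

  greedy : ∀ a k → k ≤ m → Partial a k
  greedy a zero _ = record
    { us = [] ; independent = _ ; terms = λ _ → [] ; #terms = λ _ → refl ; terms∈S = λ _ → []
    ; head-< = λ _ _ () ; head-≥ = λ _ _ _ → refl ; tail = λ _ _ → refl }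
  greedy a (suc k) k<m with greedy a k (ℕ.<⇒≤ k<m)
  ... | P with next k k<m (a (fromℕ< k<m)) (Partial.us P)
  ... | u , u∉ , term = record
    { us          = u ∷ us
    ; independent = u∉ , independent
    ; terms       = λ D → (coef D , point D) ∷ terms (lower D)
    ; #terms      = λ D → cong suc (#terms (lower D))
    ; terms∈S     = λ D → proj₁ (proj₂ (proj₂ (term (leading D)))) ∷ terms∈S (lower D)
    ; head-<      = λ D j j<1+k → trans (cong (_+ lincomb (terms (lower D)) (j ↑ˡ n)) (head D j)) (below D j j<1+k)
    ; head-≥      = λ D j k<j → begin
        coef D * point D (j ↑ˡ n) + lincomb (terms (lower D)) (j ↑ˡ n)
          ≡⟨ cong₂ _+_ (head D j) (head-≥ (lower D) j (ℕ.<⇒≤ k<j)) ⟩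
        a i * unit i j + 0#    ≡⟨ +-identityʳ _ ⟩
        a i * unit i j         ≡⟨ cong (a i *_) (unit-≢ {i} {j} λ { refl → ℕ.<⇒≢ k<j (sym i≡k) }) ⟩
        a i * 0#               ≡⟨ zeroʳ _ ⟩
        0#                     ∎
    ; tail        = λ D l → cong₂ _+_
        (trans (proj₂ (proj₂ (proj₂ (proj₂ (term (leading D))))) l) (*-comm u _)) (tail (lower D) l)
    }
    where
    open Partial P
    i : Fin m
    i = fromℕ< k<m
    i≡k : toℕ i ≡ k
    i≡k = Fin.toℕ-fromℕ< k<m
    -- The leading base-s digits are the coefficients of the new element `u`; the remainders are
    -- passed on to the earlier steps, matching the recursion in `comb`.
    leading : (Fin n → Fin (s ℕ.^ suc k)) → Fin n → Fin s
    leading D l = quotient {s} (s ℕ.^ k) (D l)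
    lower : (Fin n → Fin (s ℕ.^ suc k)) → Fin n → Fin (s ℕ.^ k)
    lower D l = remainder {s} (s ℕ.^ k) (D l)
    coef : (Fin n → Fin (s ℕ.^ suc k)) → Carrier
    coef D = proj₁ (term (leading D))
    point : (Fin n → Fin (s ℕ.^ suc k)) → Point
    point D = proj₁ (proj₂ (term (leading D)))
    head : ∀ D (j : Fin m) → coef D * point D (j ↑ˡ n) ≡ a i * unit i j
    head D = proj₁ (proj₂ (proj₂ (proj₂ (term (leading D)))))
    below : ∀ D (j : Fin m) → toℕ j < suc k → a i * unit i j + lincomb (terms (lower D)) (j ↑ˡ n) ≡ a j
    below D j j<1+k with i Fin.≟ j
    ... | yes refl = begin
      a i * 1# + lincomb (terms (lower D)) (i ↑ˡ n)
        ≡⟨ cong₂ _+_ (*-identityʳ _) (head-≥ (lower D) i (ℕ.≤-reflexive (sym i≡k))) ⟩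
      a i + 0#               ≡⟨ +-identityʳ _ ⟩
      a i                    ∎
    ... | no i≢j = begin
      a i * 0# + lincomb (terms (lower D)) (j ↑ˡ n)
        ≡⟨ cong₂ _+_ (zeroʳ _) (head-< (lower D) j (ℕ.≤∧≢⇒< (ℕ.s≤s⁻¹ j<1+k)
             λ j≡k → i≢j (Fin.toℕ-injective (trans i≡k (sym j≡k))))) ⟩
      0# + a j               ≡⟨ +-identityˡ _ ⟩
      a j                    ∎

  -- After m steps the chosen elements form a basis, so every tail coordinate of `P` has digits;
  -- these select the m = ρ + 1 terms.
  allSaturated : AllSaturated ρ S
  allSaturated P _ = terms D , ℕ.≤-reflexive (#terms D) , terms∈S D , λ i →
    subst (λ i → P i ≡ lincomb (terms D) i) (Fin.join-splitAt m n i) (coordinate (splitAt m i))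
    where
    open Partial (greedy (λ i → P (i ↑ˡ n)) m ℕ.≤-refl)
    D : Fin n → Fin (s ℕ.^ m)
    D l = Span.digits (basis-spans order≡ us independent (P (m ↑ʳ l)))
    coordinate : ∀ i → P (join m n i) ≡ lincomb (terms D) (join m n i)
    coordinate (inj₁ i) = sym (head-< D i (Fin.toℕ<n i))
    coordinate (inj₂ l) = sym (trans (tail D l) (Span.value (basis-spans order≡ us independent (P (m ↑ʳ l)))))

  -- Minimality of the saturation parameter

  -- Light points are disjointly supported on the first m coordinates.
  light-combination : ∀ xs → All Light (points xs) → (∀ (i : Fin m) → lincomb xs (i ↑ˡ n) ≢ 0#) → m ≤ length xs
  light-combination xs lights ≢0 = ℕ.≤-trans (Fin.injective⇒≤ {f = Any.index ∘ support} injective)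
    (ℕ.≤-reflexive (length-points xs))
    where
    support : ∀ (i : Fin m) → Any (λ v → v (i ↑ˡ n) ≢ 0#) (points xs)
    support i = lincomb-support xs (i ↑ˡ n) (≢0 i)
    injective : ∀ {i j} → Any.index (support i) ≡ Any.index (support j) → i ≡ j
    injective {i} {j} same = All.lookup lights (∈-lookup (Any.index (support i))) i j (lookup-index (support i))
      (subst (λ k → lookup (points xs) k (j ↑ˡ n) ≢ 0#) (sym same) (lookup-index (support j)))

  -- The all-one vector is nonzero at all m head coordinates, so at least m = ρ + 1 light points are
  -- needed, more than the r + 1 available.
  not-allSaturated : ∀ r → r < ρ → ¬ AllSaturated r S
  not-allSaturated r r<ρ sat with sat (λ _ → 1#) (λ 1≡0 → 0≢1 (sym (1≡0 zero)))
  ... | xs , #xs≤ , xs∈S , eq = ℕ.<⇒≱ (s≤s r<ρ) (ℕ.≤-trans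
    (light-combination xs (All.map (All.lookup allPoints-light ∘ ⊆-original) xs∈S)
      (λ i ≡0 → 0≢1 (sym (trans (eq (i ↑ˡ n)) ≡0)))) #xs≤)

  isSaturatingSet : IsSaturatingSet ρ S
  isSaturatingSet = isPointSet , allSaturated , not-allSaturated

  #S≤ : length S ≤ triangle m ℕ.* s ℕ.^ n ℕ.+ geo s n
  #S≤ = ℕ.≤-trans shorter (ℕ.≤-reflexive length-allPoints)

-- Specialisation to the given dimension and prime power

open import Data.Nat using (_+_; _*_; _^_)

theorem7p13 : (N ρ : ℕ) → 1 < ρ → ρ < N →
    (q' : ℕ) → IsPrimePower q' →
    (F : FiniteField) → FiniteField.order F ≡ q' ^ suc ρ →
    Σ (List (Projective.Vec F N)) λ S →
    Projective.IsSaturatingSet F N ρ S ×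
    2 * (q' ∸ 1) * length S
    ≤ (ρ + 1) * (ρ + 2) * (q' ∸ 1) * q' ^ (N ∸ ρ)
    + 2 * ρ * (ρ + 1) * (q' ^ (N ∸ ρ) ∸ 1)
theorem7p13 N ρ 1<ρ ρ<N q' (p , k , pr , 1≤k , refl) F order≡ with ℕ.m≤n⇒∃[o]m+o≡n ρ<N
... | n′ , refl = by-dimension (ℕ.+-suc ρ n′)
  where
  1<q' : 1 < p ^ k
  1<q' = ℕ.<-≤-trans (ℕ.nonTrivial⇒n>1 p {{prime⇒nonTrivial pr}})
    (subst (_≤ p ^ k) (ℕ.*-identityʳ p) (ℕ.^-monoʳ-≤ p {{prime⇒nonZero pr}} 1≤k))
  open Construction F ρ n′ 1<q' (Field.subfield F k ρ pr 1<q' order≡) order≡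
  -- The hypothesis ρ < N presents N as `suc ρ + n′`, whereas the construction lives in dimension
  -- `ρ + suc n′`. Generalising the dimension to `M` lets the equation between them be matched.
  by-dimension : ∀ {M} → ρ + suc n′ ≡ M → Σ (List (Projective.Vec F M)) λ S →
    Projective.IsSaturatingSet F M ρ S ×
    2 * (q' ∸ 1) * length S
    ≤ (ρ + 1) * (ρ + 2) * (q' ∸ 1) * q' ^ (M ∸ ρ)
    + 2 * ρ * (ρ + 1) * (q' ^ (M ∸ ρ) ∸ 1)
  by-dimension refl rewrite ℕ.m+n∸m≡n ρ (suc n′) =
    S , isSaturatingSet , size-bound {n = suc n′} 1<q' (ℕ.<⇒≤ 1<ρ) #S≤
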